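{- Let $q$ be a prime power, and let $n_t = q^{2^t - 1}$ for every integer $t \geq 1$. For $t\geq 1$, let $H_t(q)$ be a subhypergraph of the affine geometry $AG_{2^t}(q)$ that is induced by the hyperedges of $n_t$ arbitrarily chosen parallel classes. Define $$A_1(q) = K_q, \qquad A_{i+1}(q) = \Gamma(A_i(q), H_i(q)), \quad i \geq 1.$$ Then, for every $t \geq 1$, the graph $A_t(q)$ has order $n_t$ and constant link $tK_{q-1}$. Moreover, the graph $A_t(3)$ is $\{C_4, C_5\}$-free and the graph $A_t(4)$ is $C_5$-free, for every $t \geq 1$.
   Context: All graphs are finite and simple; order means number of vertices. A graph $G$ has constant link $L$ if for every vertex $v$ the subgraph induced by the open neighborhood $N(v)$ is isomorphic to $L$; $tL$ is the disjoint union of $t$ copies of $L$. "$C_\ell$-free" means containing no cycle of length $\ell$ as a (not necessarily induced) subgraph. For $m\ge2$, the affine geometry $AG_m(q)$ is regarded as the $q$-uniform hypergraph with vertex set $\mathbb{F}_q^m$ whose hyperedges are the affine lines ($1$-dimensional affine subspaces). Its lines are partitioned into $\frac{q^m-1}{q-1}$ parallel classes, each consisting of $q^{m-1}$ pairwise disjoint lines covering $\mathbb{F}_q^m$. The hypergraph $H_t(q)$ has vertex set $\mathbb{F}_q^{2^t}$ and as hyperedges all lines of $n_t$ chosen parallel classes; it is $n_t$-regular. Construction of $\Gamma(G,H)$ (with the clique $K_q$): let $G$ be a graph of order $n$ and constant link $sK_{q-1}$ for some $s\ge1$, and $H$ an $n$-regular $q$-uniform hypergraph (every vertex in exactly $n$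 edges, every edge of size $q$) with vertices $x_1,\dots,x_N$. (1) At each vertex $x$ of $H$ enumerate the hyperedges containing $x$ as $E_{x,1},\dots,E_{x,n}$. (2) Take $N$ disjoint copies of $G$ on vertex sets $V_1,\dots,V_N$, $V_i=\{v_{i,1},\dots,v_{i,n}\}$, and set $V(\Gamma)=V_1\cup\dots\cup V_N$. (3) With each edge $E$ of $H$ associate the $q$-element set $f(E)\subseteq V(\Gamma)$ defined by $v_{i,j}\in f(E)$ if and only if $E_{x_i,j}=E$. (4) For each hyperedge $E$ of $H$, place a copy of $K_q$ on the set $f(E)$. The resulting graph (for any choice of the enumerations) is $\Gamma(G,H)$. -}

module Defs where

open import Algebra.Structures using (IsCommutativeRing)
open import Data.Fin using (Fin; toℕ)
open import Data.Nat using (ℕ; suc; _∸_; _^_; _≥_; NonZero)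
open import Data.Nat.DivMod using (_mod_)
open import Data.Nat.Primality using (Prime)
open import Data.Product using (Σ-syntax; ∃; ∃₂; _×_; _,_; proj₁)
open import Data.Vec using (Vec; map; replicate; zipWith)
open import Function.Base using (_∘_)
open import Function.Bundles using (_↔_; _⇔_; Inverse)
open import Function.Definitions using (Injective)
open import Level using (0ℓ)
open import Relation.Binary.PropositionalEquality using (_≡_; _≢_; refl; sym)
open import Relation.Nullary using (¬_)
open import Relation.Unary using (Pred; _∈_; _≐_)

record Graph : Set₁ where
  field
    V      : Set
    Adj    : V → V → Set
    symm   : ∀ {u v} → Adj u v → Adj v u
    irrefl : ∀ {v} → ¬ Adj v v

open Graph

HasOrder : Graph → ℕ → Set
HasOrder G n = V G ↔ Fin n

K : ℕ → Graph
K n = record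
  { V      = Fin n
  ; Adj    = _≢_
  ; symm   = λ u≢v v≡u → u≢v (sym v≡u)
  ; irrefl = λ v≢v → v≢v refl
  }

-- t · L is the disjoint union of t copies of L.
infixr 7 _·_
_·_ : ℕ → Graph → Graph
t · L = record
  { V      = Fin t × V L
  ; Adj    = λ (i , a) (j , b) → i ≡ j × Adj L a b
  ; symm   = λ (i≡j , ab) → sym i≡j , symm L ab
  ; irrefl = λ (_ , aa) → irrefl L aa
  }

-- The subgraph of G induced by the vertex set P is isomorphic to L.  The
-- isomorphism is a bijection from V L onto the subset P itself rather than
-- onto Σ (V G) P, in which a vertex would occur once per proof of membership.
record InducedIso (G : Graph) (P : Pred (V G) 0ℓ) (L : Graph) : Set where
  field
    vertex    : V L → V G
    injective : Injective _≡_ _≡_ vertex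
    image     : ∀ u → u ∈ P ⇔ (∃ λ a → vertex a ≡ u)
    adjacency : ∀ a b → Adj L a b ⇔ Adj G (vertex a) (vertex b)

ConstantLink : Graph → Graph → Set
ConstantLink G L = ∀ v → InducedIso G (Adj G v) L

-- A cycle of length ℓ, not necessarily induced; meaningful for ℓ ≥ 3.
record Cycle (G : Graph) (ℓ : ℕ) .{{_ : NonZero ℓ}} : Set where
  field
    vertex    : Fin ℓ → V G
    injective : Injective _≡_ _≡_ vertex
    adjacent  : ∀ i → Adj G (vertex i) (vertex (suc (toℕ i) mod ℓ))

C[_]-free : (ℓ : ℕ) .{{_ : NonZero ℓ}} → Graph → Set
C[ ℓ ]-free G = ¬ Cycle G ℓ

-- Hyperedges are sets of vertices: two elements of Edge denote the same
-- hyperedge exactly when their vertex sets agree (_≈ₑ_).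
record Hypergraph : Set₁ where
  field
    Vertex : Set
    Edge   : Set
    verts  : Edge → Pred Vertex 0ℓ

  _≈ₑ_ : Edge → Edge → Set
  E ≈ₑ E′ = verts E ≐ verts E′

open Hypergraph

-- E_{x,1}, …, E_{x,n}: the hyperedges containing x, each listed exactly once.
record Enumeration (H : Hypergraph) (n : ℕ) (x : Vertex H) : Set where
  field
    edge     : Fin n → Edge H
    incident : ∀ j → x ∈ verts H (edge j)
    distinct : ∀ {j k} → _≈ₑ_ H (edge j) (edge k) → j ≡ k
    complete : ∀ E → x ∈ verts H E → ∃ λ j → _≈ₑ_ H (edge j) E

-- The vertex v_{x,j} is the pair (x , j).  The bijection copy x names the
-- vertices of the x-th copy of G, so that G has order n; an enumeration at
-- every vertex makes H n-regular.
module _ (G : Graph) (H : Hypergraph) {n : ℕ}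
         (copy : Vertex H → V G ↔ Fin n)
         (enum : ∀ x → Enumeration H n x) where

  f : Edge H → Pred (Vertex H × Fin n) 0ℓ
  f E (x , j) = _≈ₑ_ H (Enumeration.edge (enum x) j) E

  data ΓAdj : Vertex H × Fin n → Vertex H × Fin n → Set where
    inCopy   : ∀ {x j k} →
               Adj G (Inverse.from (copy x) j) (Inverse.from (copy x) k) →
               ΓAdj (x , j) (x , k)
    inClique : ∀ {u v} E → u ∈ f E → v ∈ f E → u ≢ v → ΓAdj u v

  Γ : Graph
  Γ = record
    { V      = Vertex H × Fin n
    ; Adj    = ΓAdj
    ; symm   = λ where
        (inCopy a)           → inCopy (symm G a)
        (inClique E p q u≢v) → inClique E q p (u≢v ∘ sym)
    ; irrefl = λ where
        (inCopy a)           → irrefl G a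
        (inClique E p q v≢v) → v≢v refl
    }

PrimePower : ℕ → Set
PrimePower q = ∃₂ λ p k → Prime p × k ≥ 1 × q ≡ p ^ k

-- A field with q elements.
record FiniteField (q : ℕ) : Set₁ where
  field
    Carrier           : Set
    _+_ _*_           : Carrier → Carrier → Carrier
    -_                : Carrier → Carrier
    0# 1#             : Carrier
    isCommutativeRing : IsCommutativeRing _≡_ _+_ _*_ -_ 0# 1#
    0≢1               : 0# ≢ 1#
    inverse           : ∀ x → x ≢ 0# → ∃ λ y → x * y ≡ 1#
    finite            : Carrier ↔ Fin q

module Affine {q : ℕ} (F : FiniteField q) (m : ℕ) where
  open FiniteField F

  Point : Set
  Point = Vec Carrier m

  infixl 6 _+ᵥ_
  infixr 7 _*ᵥ_

  0ᵥ : Point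
  0ᵥ = replicate m 0#

  _+ᵥ_ : Point → Point → Point
  _+ᵥ_ = zipWith _+_

  _*ᵥ_ : Carrier → Point → Point
  c *ᵥ v = map (c *_) v

  record Line : Set where
    field
      base        : Point
      direction   : Point
      direction≢0 : direction ≢ 0ᵥ

  open Line public

  points : Line → Pred Point 0ℓ
  points ℓ v = ∃ λ s → v ≡ base ℓ +ᵥ s *ᵥ direction ℓ

  -- Directions are nonzero, so c is nonzero and this is an equivalence
  -- relation: the two lines are translates of the same 1-dimensional subspace.
  _∥_ : Line → Line → Set
  ℓ ∥ ℓ′ = ∃ λ c → direction ℓ ≡ c *ᵥ direction ℓ′

  -- n distinct parallel classes, each given by one of its lines.
  record ParallelClasses (n : ℕ) : Set where
    field
      line     : Fin n → Line
      distinct : ∀ {i j} → line i ∥ line j → i ≡ j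

  linesOf : ∀ {n} → ParallelClasses n → Hypergraph
  linesOf C = record
    { Vertex = Point
    ; Edge   = Σ[ ℓ ∈ Line ] ∃ λ i → ℓ ∥ ParallelClasses.line C i
    ; verts  = points ∘ proj₁
    }

n[_,_] : ℕ → ℕ → ℕ
n[ q , t ] = q ^ (2 ^ t ∸ 1)

-- IsA F t G: the graph G is A_t(q) for some choice of the parallel classes,
-- of the names of the vertices in the copies and of the enumerations made at
-- the steps of the recursion.
data IsA {q : ℕ} (F : FiniteField q) : ℕ → Graph → Set₁ where
  A-one : IsA F 1 (K q)
  A-suc : ∀ {i G} → IsA F i G →
          (C : Affine.ParallelClasses F (2 ^ i) n[ q , i ]) →
          let H = Affine.linesOf F (2 ^ i) C in
          (copy : Vertex H → V G ↔ Fin n[ q , i ]) →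
          (enum : ∀ x → Enumeration H n[ q , i ] x) →
          IsA F (suc i) (Γ G H copy enum)

{-# OPTIONS --safe #-}
module Submission where

-- Lying in a common copy of G and lying in a common clique f(E) are two
-- equivalence relations on the vertices of Γ(G, H) that cover the edges and meet
-- only in equality.  Hence the link of a vertex is its link in the copy together
-- with a disjoint, nonadjacent K_{q-1}.  A cycle that uses both relations
-- alternates between runs of copy edges and runs of clique edges.  It has at
-- least two runs of each kind, and exactly two would give two hyperedges through
-- the same two points, which is impossible in a linear hypergraph.  So a cycle
-- of length at most 5 stays in one copy, where induction applies, or in one
-- clique, which has only q vertices.

open import Defs
open import Algebra.Structures using (IsCommutativeRing)
open import Data.Bool using (Bool; true; false; _≟_)
open import Data.Bool.Properties using (¬-not)
open import Data.Empty using (⊥; ⊥-elim)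
open import Data.Fin using (Fin; zero; suc; toℕ; punchIn; punchOut)
open import Data.Fin.Patterns
open import Data.Fin.Properties
  using (*↔×; inj⇒≟; injective⇒≤; punchIn-injective; punchIn-punchOut; punchInᵢ≢i; suc-injective)
open import Data.Nat using (ℕ; zero; suc; _∸_; _≥_; _<_; _≤_; _^_; s≤s)
import Data.Nat as ℕ
import Data.Nat.Properties as ℕ
open import Data.Nat.DivMod using (_mod_)
open import Data.Product using (∃; _×_; _,_; proj₁; proj₂)
open import Data.Product.Function.NonDependent.Propositional using (_×-↔_)
open import Data.Sum using (inj₁; inj₂; [_,_]′)
open import Data.Vec using (Vec; []; _∷_; map; uncons; zipWith)
open import Data.Vec.Functional using (Vector; removeAt)
open import Data.Vec.Properties
  using (map-∘; map-cong; map-const; map-id;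
         zipWith-assoc; zipWith-identityˡ; zipWith-identityʳ; zipWith-inverseˡ)
open import Data.Unit using (tt)
open import Function.Base using (_∘_; id)
open import Function.Bundles using (_↔_; _⇔_; mk⇔; mk↔ₛ′; Equivalence; Injection; Inverse)
open import Function.Definitions using (Injective)
open import Function.Properties.Inverse using (↔-sym; ↔-trans; ↔-refl; ↔⇒↣)
open import Level using (0ℓ)
open import Relation.Binary.PropositionalEquality
  using (_≡_; _≢_; refl; sym; trans; cong; cong₂; subst; subst₂; ≢-sym; module ≡-Reasoning)
open import Relation.Nullary using (¬_; yes; no; contradiction)
open import Relation.Unary using (Pred; _∈_; _≐_; _⊆_; _∪_; ∅; U)
open import Relation.Unary.Properties using (≐-refl; ≐-sym; ≐-trans)

open Graph
open Hypergraph

private variable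
  G L : Graph
  n q r t : ℕ

-- Finite subsets, and induced subgraphs built up component by component.

-- The bijection is onto the subset itself, as in `InducedIso`: a point may have several proofs of
-- membership in a line or in a clique.
record Listing {A : Set} (n : ℕ) (P : Pred A 0ℓ) : Set where
  field
    elem      : Fin n → A
    injective : Injective _≡_ _≡_ elem
    image     : ∀ x → x ∈ P ⇔ (∃ λ a → elem a ≡ x)

induced-resp-≐ : {P Q : Pred (V G) 0ℓ} → P ≐ Q → InducedIso G P L → InducedIso G Q L
induced-resp-≐ (P⊆Q , Q⊆P) iso = record
  { vertex    = vertex
  ; injective = injective
  ; image     = λ u → mk⇔ (Equivalence.to (image u) ∘ Q⊆P) (P⊆Q ∘ Equivalence.from (image u))
  ; adjacency = adjacency
  }
  where open InducedIso iso

induced-∅ : InducedIso G ∅ (0 · L)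
induced-∅ = record
  { vertex    = λ ()
  ; injective = λ { {()} }
  ; image     = λ _ → mk⇔ (λ ()) (λ ())
  ; adjacency = λ ()
  }

-- Component `zero` of `suc t · L` is carried by `P` and the later ones by `Q`. Each step of the
-- recursion adds one component to a link in this way.
induced-∪ : {P Q : Pred (V G) 0ℓ} →
            (∀ {u v} → u ∈ P → v ∈ Q → u ≢ v) →
            (∀ {u v} → u ∈ P → v ∈ Q → ¬ Adj G u v) →
            InducedIso G P L → InducedIso G Q (t · L) → InducedIso G (P ∪ Q) (suc t · L)
induced-∪ {G = G} {L = L} {t = t} {P} {Q} disjoint nonadjacent isoP isoQ = record
  { vertex    = vertex
  ; injective = injective
  ; image     = λ u → mk⇔ [ toP u , toQ u ]′ (from u)
  ; adjacency = adjacency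
  }
  where
  module P = InducedIso isoP
  module Q = InducedIso isoQ

  vertex : Fin (suc t) × V L → V G
  vertex (zero  , a) = P.vertex a
  vertex (suc i , a) = Q.vertex (i , a)

  vertex∈P : ∀ a → P.vertex a ∈ P
  vertex∈P a = Equivalence.from (P.image _) (a , refl)

  vertex∈Q : ∀ a → Q.vertex a ∈ Q
  vertex∈Q a = Equivalence.from (Q.image _) (a , refl)

  injective : Injective _≡_ _≡_ vertex
  injective {zero  , a} {zero  , b} eq = cong (zero ,_) (P.injective eq)
  injective {zero  , a} {suc j , b} eq = contradiction eq (disjoint (vertex∈P a) (vertex∈Q _))
  injective {suc i , a} {zero  , b} eq = contradiction (sym eq) (disjoint (vertex∈P b) (vertex∈Q _))
  injective {suc i , a} {suc j , b} eq = cong (λ (k , c) → suc k , c) (Q.injective eq)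

  toP : ∀ u → u ∈ P → ∃ λ a → vertex a ≡ u
  toP u u∈P = let a , eq = Equivalence.to (P.image u) u∈P in (zero , a) , eq

  toQ : ∀ u → u ∈ Q → ∃ λ a → vertex a ≡ u
  toQ u u∈Q = let (i , a) , eq = Equivalence.to (Q.image u) u∈Q in (suc i , a) , eq

  from : ∀ u → (∃ λ a → vertex a ≡ u) → u ∈ P ∪ Q
  from u ((zero  , a) , refl) = inj₁ (vertex∈P a)
  from u ((suc i , a) , refl) = inj₂ (vertex∈Q _)

  adjacency : ∀ a b → Adj (suc t · L) a b ⇔ Adj G (vertex a) (vertex b)
  adjacency (zero , a) (zero , b) = mk⇔
    (λ (_ , ab) → Equivalence.to (P.adjacency a b) ab)
    (λ ab → refl , Equivalence.from (P.adjacency a b) ab)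
  adjacency (zero , a) (suc j , b) = mk⇔ (λ ())
    (λ ab → contradiction ab (nonadjacent (vertex∈P a) (vertex∈Q _)))
  adjacency (suc i , a) (zero , b) = mk⇔ (λ ())
    (λ ab → contradiction (symm G ab) (nonadjacent (vertex∈P b) (vertex∈Q _)))
  adjacency (suc i , a) (suc j , b) = mk⇔
    (λ (i≡j , ab) → Equivalence.to (Q.adjacency _ _) (suc-injective i≡j , ab))
    (λ ab → let i≡j , ab′ = Equivalence.from (Q.adjacency _ _) ab in cong suc i≡j , ab′)

-- Deleting a vertex from a clique leaves a clique: `punchIn k` skips the position `k` of `u` in the
-- listing.
induced-clique : {P : Pred (V G) 0ℓ} → Listing (suc r) P →
                 (∀ {u v} → u ∈ P → v ∈ P → u ≢ v → Adj G u v) →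
                 ∀ {u} → u ∈ P → InducedIso G (λ v → v ∈ P × u ≢ v) (K r)
induced-clique {G = G} {P = P} listing clique {u} u∈P = record
  { vertex    = vertex
  ; injective = punchIn-injective k _ _ ∘ injective
  ; image     = λ v → mk⇔ (to v) (from v)
  ; adjacency = λ a b → mk⇔
      (λ a≢b → clique (elem∈P _) (elem∈P _) (a≢b ∘ punchIn-injective k _ _ ∘ injective))
      (λ { ab refl → irrefl G ab })
  }
  where
  open Listing listing
  k = proj₁ (Equivalence.to (image u) u∈P)

  elem-k : elem k ≡ u
  elem-k = proj₂ (Equivalence.to (image u) u∈P)

  vertex = elem ∘ punchIn k

  elem∈P : ∀ a → elem a ∈ P
  elem∈P a = Equivalence.from (image _) (a , refl)

  to : ∀ v → v ∈ P × u ≢ v → ∃ λ a → vertex a ≡ v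
  to v (v∈P , u≢v) =
    let b , eq = Equivalence.to (image v) v∈P
        k≢b k≡b = u≢v (trans (sym elem-k) (trans (cong elem k≡b) eq))
    in punchOut k≢b , trans (cong elem (punchIn-punchOut k≢b)) eq

  from : ∀ v → (∃ λ a → vertex a ≡ v) → v ∈ P × u ≢ v
  from v (a , refl) = elem∈P _ , λ u≡v → punchInᵢ≢i k a (injective (trans (sym u≡v) (sym elem-k)))

-- Complete graphs, the start of the recursion.

K-constantLink : ConstantLink (K (suc r)) (1 · K r)
K-constantLink v =
  -- The single component of `1 · K r` is added to the empty graph `0 · K r`.
  induced-resp-≐ ([ proj₂ , (λ ()) ]′ , (λ v≢w → inj₁ (tt , v≢w)))
    (induced-∪ (λ _ ()) (λ _ ())
      (induced-clique everything (λ _ _ → id) tt)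
      induced-∅)
  where
  everything : Listing _ U
  everything = record
    { elem      = id
    ; injective = id
    ; image     = λ x → mk⇔ (λ _ → x , refl) (λ _ → tt)
    }

K-cycle-free : q ≤ n → C[ suc n ]-free (K q)
K-cycle-free q≤n C = ℕ.<⇒≱ (s≤s q≤n) (injective⇒≤ (Cycle.injective C))

-- Cycles of length at most 5 under two transitive relations.

-- Two consecutive edges of one colour merge into a single edge, which shortens
-- the cycle; odd cycles always contain such a pair, so that only the
-- alternating quadrangle has to be excluded by hypothesis.
module Coloured
  {A : Set} (_~[_]_ : A → Bool → A → Set)
  (~-trans : ∀ {c u v w} → u ~[ c ] v → v ~[ c ] w → u ~[ c ] w)
  (same-colour : ∀ {c d u v} → u ~[ c ] v → v ~[ d ] u → u ≢ v → c ≡ d)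
  (no-rectangle : ∀ {u v w z} → u ≢ v → v ≢ w →
                  u ~[ true ] v → v ~[ false ] w → w ~[ true ] z → z ~[ false ] u → ⊥)
  where

  private variable c₀ c₁ c₂ c₃ c₄ : Bool

  removeAt-injective : {v : Vector A (suc n)} → Injective _≡_ _≡_ v →
                       ∀ i → Injective _≡_ _≡_ (removeAt v i)
  removeAt-injective inj i = punchIn-injective i _ _ ∘ inj

  alternate : c₀ ≢ c₁ → c₁ ≢ c₂ → c₀ ≡ c₂
  alternate c₀≢c₁ c₁≢c₂ = trans (¬-not c₀≢c₁) (sym (¬-not (≢-sym c₁≢c₂)))

  triangle : (v : Vector A 3) → Injective _≡_ _≡_ v →
             v 0F ~[ c₀ ] v 1F → v 1F ~[ c₁ ] v 2F → v 2F ~[ c₂ ] v 0F →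
             c₀ ≡ c₁ × c₁ ≡ c₂
  triangle {c₀} {c₁} {c₂} v inj e₀ e₁ e₂ with c₀ ≟ c₁ | c₁ ≟ c₂
  ... | yes refl | _ = refl , same-colour (~-trans e₀ e₁) e₂ (λ eq → contradiction (inj eq) λ ())
  ... | no _ | yes refl = same-colour e₀ (~-trans e₁ e₂) (λ eq → contradiction (inj eq) λ ()) , refl
  -- Two changes of colour return to `c₀`, so the last edge and the first one merge at `v 0F`.
  ... | no c₀≢c₁ | no c₁≢c₂ with refl ← alternate c₀≢c₁ c₁≢c₂ =
    contradiction (same-colour e₁ (~-trans e₂ e₀) (λ eq → contradiction (inj eq) λ ())) c₁≢c₂

  alternating : (v : Vector A 4) → Injective _≡_ _≡_ v → c₀ ≢ c₁ →
                v 0F ~[ c₀ ] v 1F → v 1F ~[ c₁ ] v 2F →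
                v 2F ~[ c₀ ] v 3F → v 3F ~[ c₁ ] v 0F → ⊥
  alternating {true}  {true}  v inj c₀≢c₁ _ _ _ _ = c₀≢c₁ refl
  alternating {false} {false} v inj c₀≢c₁ _ _ _ _ = c₀≢c₁ refl
  alternating {true}  {false} v inj _ e₀ e₁ e₂ e₃ =
    no-rectangle ((λ ()) ∘ inj {0F} {1F}) ((λ ()) ∘ inj {1F} {2F}) e₀ e₁ e₂ e₃
  -- The cycle is rotated by one vertex, because `no-rectangle` starts with a `true` edge.
  alternating {false} {true}  v inj _ e₀ e₁ e₂ e₃ =
    no-rectangle ((λ ()) ∘ inj {1F} {2F}) ((λ ()) ∘ inj {2F} {3F}) e₁ e₂ e₃ e₀

  -- Merging two consecutive edges of one colour removes the vertex between them and leaves a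
  -- triangle. If the first three pairs all differ in colour, the colours alternate around the whole
  -- cycle.
  quadrangle : (v : Vector A 4) → Injective _≡_ _≡_ v →
               v 0F ~[ c₀ ] v 1F → v 1F ~[ c₁ ] v 2F → v 2F ~[ c₂ ] v 3F → v 3F ~[ c₃ ] v 0F →
               c₀ ≡ c₁ × c₁ ≡ c₂ × c₂ ≡ c₃
  quadrangle {c₀} {c₁} {c₂} {c₃} v inj e₀ e₁ e₂ e₃ with c₀ ≟ c₁ | c₁ ≟ c₂ | c₂ ≟ c₃
  ... | yes refl | _ | _ =
    refl , triangle (removeAt v 1F) (removeAt-injective inj 1F) (~-trans e₀ e₁) e₂ e₃
  ... | no _ | yes refl | _ =
    let p , q = triangle (removeAt v 2F) (removeAt-injective inj 2F) e₀ (~-trans e₁ e₂) e₃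
    in p , refl , q
  ... | no _ | no _ | yes refl =
    let p , q = triangle (removeAt v 3F) (removeAt-injective inj 3F) e₀ e₁ (~-trans e₂ e₃)
    in p , q , refl
  ... | no c₀≢c₁ | no c₁≢c₂ | no c₂≢c₃
    with refl ← alternate c₀≢c₁ c₁≢c₂ | refl ← alternate c₁≢c₂ c₂≢c₃ = 
    ⊥-elim (alternating v inj c₀≢c₁ e₀ e₁ e₂ e₃)

  pentagon : (v : Vector A 5) → Injective _≡_ _≡_ v →
             v 0F ~[ c₀ ] v 1F → v 1F ~[ c₁ ] v 2F → v 2F ~[ c₂ ] v 3F →
             v 3F ~[ c₃ ] v 4F → v 4F ~[ c₄ ] v 0F →
             c₀ ≡ c₁ × c₁ ≡ c₂ × c₂ ≡ c₃ × c₃ ≡ c₄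
  pentagon {c₀} {c₁} {c₂} {c₃} {c₄} v inj e₀ e₁ e₂ e₃ e₄
    with c₀ ≟ c₁ | c₁ ≟ c₂ | c₂ ≟ c₃ | c₃ ≟ c₄
  ... | yes refl | _ | _ | _ =
    refl , quadrangle (removeAt v 1F) (removeAt-injective inj 1F) (~-trans e₀ e₁) e₂ e₃ e₄
  ... | no _ | yes refl | _ | _ =
    let p , q , r = quadrangle (removeAt v 2F) (removeAt-injective inj 2F) e₀ (~-trans e₁ e₂) e₃ e₄
    in p , refl , q , r
  ... | no _ | no _ | yes refl | _ =
    let p , q , r = quadrangle (removeAt v 3F) (removeAt-injective inj 3F) e₀ e₁ (~-trans e₂ e₃) e₄
    in p , q , refl , r
  ... | no _ | no _ | no _ | yes refl =
    let p , q , r = quadrangle (removeAt v 4F) (removeAt-injective inj 4F) e₀ e₁ e₂ (~-trans e₃ e₄)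
    in p , q , r , refl
  -- Four changes of colour give `c₀ ≡ c₄`. Merging the last edge with the first removes `v 0F`, and
  -- the remaining quadrangle forces `c₁ ≡ c₂`.
  ... | no c₀≢c₁ | no c₁≢c₂ | no c₂≢c₃ | no c₃≢c₄
    with refl ← trans (alternate c₀≢c₁ c₁≢c₂) (alternate c₂≢c₃ c₃≢c₄) =
    contradiction
      (proj₁ (quadrangle (removeAt v 0F) (removeAt-injective inj 0F) e₁ e₂ e₃ (~-trans e₄ e₀)))
      c₁≢c₂

  -- Phrased through vertices rather than edges: everything is related to the first vertex, which
  -- places the cycle in one copy or in one clique.
  Monochromatic : Vector A (suc n) → Set
  Monochromatic v = ∃ λ c → ∀ i → v 0F ~[ c ] v i

  monochromatic₄ : (v : Vector A 4) → Injective _≡_ _≡_ v →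
                   (∀ i → ∃ λ c → v i ~[ c ] v (suc (toℕ i) mod 4)) → Monochromatic v
  monochromatic₄ v inj edges
    with _ , e₀ ← edges 0F | _ , e₁ ← edges 1F | _ , e₂ ← edges 2F | c , e₃ ← edges 3F
    with refl , refl , refl ← quadrangle v inj e₀ e₁ e₂ e₃ = c , λ where
      -- Reflexivity is not among the assumptions on the relations; a full turn around the cycle
      -- relates `v 0F` to itself.
      0F → ~-trans e₀ (~-trans e₁ (~-trans e₂ e₃))
      1F → e₀
      2F → ~-trans e₀ e₁
      3F → ~-trans e₀ (~-trans e₁ e₂)

  monochromatic₅ : (v : Vector A 5) → Injective _≡_ _≡_ v →
                   (∀ i → ∃ λ c → v i ~[ c ] v (suc (toℕ i) mod 5)) → Monochromatic v
  monochromatic₅ v inj edges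
    with _ , e₀ ← edges 0F | _ , e₁ ← edges 1F | _ , e₂ ← edges 2F | _ , e₃ ← edges 3F
       | c , e₄ ← edges 4F
    with refl , refl , refl , refl ← pentagon v inj e₀ e₁ e₂ e₃ e₄ = c , λ where
      0F → ~-trans e₀ (~-trans e₁ (~-trans e₂ (~-trans e₃ e₄)))
      1F → e₀
      2F → ~-trans e₀ e₁
      3F → ~-trans e₀ (~-trans e₁ e₂)
      4F → ~-trans e₀ (~-trans e₁ (~-trans e₂ e₃))

-- Copies and cliques in Γ(G, H), and its short cycles.

Uniform : ℕ → Hypergraph → Set
Uniform q H = ∀ E → Listing q (verts H E)

Linear : Hypergraph → Set
Linear H = ∀ E E′ {x y} → x ≢ y → x ∈ verts H E → y ∈ verts H E →
           x ∈ verts H E′ → y ∈ verts H E′ → _≈ₑ_ H E E′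

module ΓProperties
  (G : Graph) (H : Hypergraph) {n : ℕ} (copy : Vertex H → V G ↔ Fin n)
  (enum : ∀ x → Enumeration H n x) (uniform : Uniform q H) where

  open Enumeration using (edge; incident; distinct; complete)

  Γ′ : Graph
  Γ′ = Γ G H copy enum

  clique : Edge H → Pred (V Γ′) 0ℓ
  clique = f G H copy enum

  edgeAt : V Γ′ → Edge H
  edgeAt (x , j) = edge (enum x) j

  -- true: in the same copy of G; false: in the same clique.
  _~[_]_ : V Γ′ → Bool → V Γ′ → Set
  u ~[ true  ] v = proj₁ u ≡ proj₁ v
  u ~[ false ] v = u ∈ clique (edgeAt v)

  ~-trans : ∀ {c u v w} → u ~[ c ] v → v ~[ c ] w → u ~[ c ] w
  ~-trans {true}  = trans
  ~-trans {false} = ≐-trans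

  -- The enumeration at a point lists each hyperedge only once, so a clique has at most one vertex
  -- in each copy.
  copy∩clique : ∀ {u v} → u ~[ true ] v → u ~[ false ] v → u ≡ v
  copy∩clique {x , j} refl e = cong (x ,_) (distinct (enum x) e)

  same-colour : ∀ {c d u v} → u ~[ c ] v → v ~[ d ] u → u ≢ v → c ≡ d
  same-colour {true}  {true}  _ _ _ = refl
  same-colour {false} {false} _ _ _ = refl
  same-colour {true}  {false} e e′ u≢v = contradiction (copy∩clique e (≐-sym e′)) u≢v
  same-colour {false} {true}  e e′ u≢v = contradiction (copy∩clique (sym e′) e) u≢v

  on-edge : ∀ {u E} → u ∈ clique E → proj₁ u ∈ verts H E
  on-edge {x , j} u∈E = proj₁ u∈E (incident (enum x) j)

  -- The copies of `u`, `v` and of `w`, `z` sit at two distinct points of `H`, both on the hyperedge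
  -- of `u` and on that of `v`. Linearity identifies these hyperedges, so `u` and `v` share a clique
  -- as well as a copy.
  no-rectangle : Linear H → ∀ {u v w z} → u ≢ v → v ≢ w →
                 u ~[ true ] v → v ~[ false ] w → w ~[ true ] z → z ~[ false ] u → ⊥
  no-rectangle linear {u} {v} {w} {z} u≢v v≢w refl vw refl zu =
    u≢v (copy∩clique refl
      (linear (edgeAt u) (edgeAt v) (λ x≡y → v≢w (copy∩clique x≡y vw))
        (incident (enum _) _) (on-edge {z} zu)
        (incident (enum _) _) (on-edge {w} (≐-sym vw))))

  colour : ∀ {u v} → Adj Γ′ u v → ∃ λ c → u ~[ c ] v
  colour (inCopy _)             = true , refl
  colour (inClique E u∈E v∈E _) = false , ≐-trans u∈E (≐-sym v∈E)

  vertexAt : ∀ x → V G → V Γ′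
  vertexAt x a = x , Inverse.to (copy x) a

  -- The point `x` is a separate argument, so that all vertices of a cycle inside one copy are named
  -- by the same bijection. The name is meaningful when `x` is the first component of the vertex.
  nameAt : Vertex H → V Γ′ → V G
  nameAt x (_ , j) = Inverse.from (copy x) j

  -- Copies of `G` are induced subgraphs: a clique edge inside a copy would join a vertex to itself.
  copy-adj : ∀ {x u v} → x ≡ proj₁ u → x ≡ proj₁ v → Adj Γ′ u v → Adj G (nameAt x u) (nameAt x v)
  copy-adj refl refl (inCopy a)               = a
  copy-adj refl refl (inClique E u∈E v∈E u≢v) =
    contradiction (copy∩clique refl (≐-trans u∈E (≐-sym v∈E))) u≢v

  -- Projection to `H` maps the clique bijectively onto `E`, since `E` occupies exactly one position
  -- in the enumeration at each of its points.
  clique-listing : ∀ E → Listing q (clique E)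
  clique-listing E = record
    { elem      = elem
    ; injective = Listing.injective (uniform E) ∘ cong proj₁
    ; image     = λ u → mk⇔ (to u) (from u)
    }
    where
    module L = Listing (uniform E)

    index : ∀ a → ∃ λ j → _≈ₑ_ H (edge (enum (L.elem a)) j) E
    index a = complete (enum (L.elem a)) E (Equivalence.from (L.image _) (a , refl))

    elem : Fin q → V Γ′
    elem a = L.elem a , proj₁ (index a)

    to : ∀ u → u ∈ clique E → ∃ λ a → elem a ≡ u
    to u u∈E =
      let a , eq = Equivalence.to (L.image (proj₁ u)) (on-edge {u} u∈E)
      in a , copy∩clique eq (≐-trans (proj₂ (index a)) (≐-sym u∈E))

    from : ∀ u → (∃ λ a → elem a ≡ u) → u ∈ clique E
    from u (a , refl) = proj₂ (index a)

  clique-free : ∀ {E m} → q < m → (v : Vector (V Γ′) m) → Injective _≡_ _≡_ v →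
                (∀ i → v i ∈ clique E) → ⊥
  clique-free {E} q<m v inj v∈E = ℕ.<⇒≱ q<m (injective⇒≤ index-injective)
    where
    open Listing (clique-listing E)

    position : ∀ i → ∃ λ a → elem a ≡ v i
    position i = Equivalence.to (image (v i)) (v∈E i)

    index-injective : Injective _≡_ _≡_ (proj₁ ∘ position)
    index-injective {i} {j} eq =
      inj (trans (sym (proj₂ (position i))) (trans (cong elem eq) (proj₂ (position j))))

  name-injective : ∀ {x u v} → x ≡ proj₁ u → x ≡ proj₁ v → nameAt x u ≡ nameAt x v → u ≡ v
  name-injective {x} refl refl eq = cong (x ,_) (Injection.injective (↔⇒↣ (↔-sym (copy x))) eq)

  module _ (linear : Linear H) where
    open Coloured _~[_]_ (λ {c} {u} {v} {w} → ~-trans {c} {u} {v} {w})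
      (λ {c} {d} {u} {v} → same-colour {c} {d} {u} {v}) (no-rectangle linear)

    -- The colouring result is a parameter, so that lengths 4 and 5 share one argument.
    cycle-free : ∀ {m} →
                 (∀ (v : Vector (V Γ′) (suc m)) → Injective _≡_ _≡_ v →
                   (∀ i → ∃ λ c → v i ~[ c ] v (suc (toℕ i) mod suc m)) → Monochromatic v) →
                 q ≤ m → C[ suc m ]-free G → C[ suc m ]-free Γ′
    cycle-free monochromatic q≤m G-free C
      with monochromatic (Cycle.vertex C) (Cycle.injective C) (colour ∘ Cycle.adjacent C)
    ... | true  , same = G-free record
      { vertex    = nameAt _ ∘ vertex
      ; injective = injective ∘ name-injective (same _) (same _)
      ; adjacent  = λ i → copy-adj (same i) (same _) (adjacent i)
      }
      where open Cycle C
    ... | false , same = clique-free (s≤s q≤m) (Cycle.vertex C) (Cycle.injective C) (≐-sym ∘ same)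

    C₄-free : q ≤ 3 → C[ 4 ]-free G → C[ 4 ]-free Γ′
    C₄-free = cycle-free monochromatic₄

    C₅-free : q ≤ 4 → C[ 5 ]-free G → C[ 5 ]-free Γ′
    C₅-free = cycle-free monochromatic₅

-- The link of a vertex of Γ(G, H).

Γ-constantLink : ∀ {H} (copy : Vertex H → V G ↔ Fin n) (enum : ∀ x → Enumeration H n x) →
                 Uniform (suc r) H → ConstantLink G (t · K r) →
                 ConstantLink (Γ G H copy enum) (suc t · K r)
Γ-constantLink {G = G} {r = r} {t = t} {H = H} copy enum uniform link u@(x , j) =
  induced-resp-≐ (from , to)
    (induced-∪ disjoint nonadjacent
      (induced-clique (clique-listing (edgeAt u))
        (λ v∈E w∈E v≢w → inClique (edgeAt u) v∈E w∈E v≢w) ≐-refl)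
      copy-link)
  where
  open ΓProperties G H copy enum uniform
  module L = InducedIso (link (nameAt x u))

  P Q : Pred (V Γ′) 0ℓ
  P v = v ∈ clique (edgeAt u) × u ≢ v
  Q v = x ≡ proj₁ v × Adj G (nameAt x u) (nameAt x v)

  to : Adj Γ′ u ⊆ P ∪ Q
  to (inCopy a)               = inj₂ (refl , a)
  to (inClique E u∈E v∈E u≢v) = inj₁ (≐-trans v∈E (≐-sym u∈E) , u≢v)

  from : P ∪ Q ⊆ Adj Γ′ u
  from (inj₁ (v∈E , u≢v)) = inClique (edgeAt u) ≐-refl v∈E u≢v
  from (inj₂ (refl , a))  = inCopy a

  disjoint : ∀ {v w} → v ∈ P → w ∈ Q → v ≢ w
  disjoint (v∈E , u≢v) (x≡ , _) refl = u≢v (copy∩clique x≡ (≐-sym v∈E))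

  -- A copy edge would bring `v` into the copy of `u`, forcing `v ≡ u`. A clique edge would bring
  -- `w` into the clique of `u`, forcing `w ≡ u` and hence a loop in `G`.
  nonadjacent : ∀ {v w} → v ∈ P → w ∈ Q → ¬ Adj Γ′ v w
  nonadjacent (v∈E , u≢v) (x≡ , _) (inCopy _) = u≢v (copy∩clique x≡ (≐-sym v∈E))
  nonadjacent (v∈E , _) (x≡ , a) (inClique E v∈E′ w∈E′ _)
    with refl ← copy∩clique x≡ (≐-trans (≐-sym v∈E) (≐-trans v∈E′ (≐-sym w∈E′))) = irrefl G a

  copy-link : InducedIso Γ′ Q (t · K r)
  copy-link = record
    { vertex    = vertexAt x ∘ L.vertex
    ; injective = λ eq → L.injective (Injection.injective (↔⇒↣ (copy x)) (vertexAt-injective eq))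
    ; image     = λ v → mk⇔ (toImage v) (fromImage v)
    ; adjacency = λ a b → mk⇔
        (λ ab → inCopy (subst₂ (Adj G) (sym (from-to _)) (sym (from-to _))
                          (Equivalence.to (L.adjacency a b) ab)))
        (λ ab → Equivalence.from (L.adjacency a b)
                  (subst₂ (Adj G) (from-to _) (from-to _) (copy-adj refl refl ab)))
    }
    where
    from-to : ∀ a → nameAt x (vertexAt x a) ≡ a
    from-to = Inverse.strictlyInverseʳ (copy x)

    vertexAt-injective : ∀ {j k} → _≡_ {A = V Γ′} (x , j) (x , k) → j ≡ k
    vertexAt-injective refl = refl

    toImage : ∀ v → v ∈ Q → ∃ λ a → vertexAt x (L.vertex a) ≡ v
    toImage (_ , k) (refl , adj) =
      let a , eq = Equivalence.to (L.image _) adj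
      in a , cong (x ,_) (trans (cong (Inverse.to (copy x)) eq) (Inverse.strictlyInverseˡ (copy x) k))

    fromImage : ∀ v → (∃ λ a → vertexAt x (L.vertex a) ≡ v) → v ∈ Q
    fromImage v (a , refl) =
      refl , subst (Adj G _) (sym (from-to _)) (Equivalence.from (L.image _) (a , refl))

-- Counting the vertices.

Vec↔Fin : ∀ {A : Set} → A ↔ Fin q → ∀ m → Vec A m ↔ Fin (q ^ m)
Vec↔Fin A↔Fin zero    = mk↔ₛ′ (λ _ → 0F) (λ _ → []) (λ { 0F → refl ; (suc ()) }) (λ { [] → refl })
Vec↔Fin A↔Fin (suc m) =
  ↔-trans (mk↔ₛ′ uncons (λ (x , xs) → x ∷ xs) (λ _ → refl) (λ { (_ ∷ _) → refl }))
    (↔-trans (A↔Fin ×-↔ Vec↔Fin A↔Fin m) (↔-sym *↔×))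

-- The left side counts the points of the affine space times the vertices of one copy.
n-suc : ∀ q i → q ^ (2 ^ i) ℕ.* n[ q , i ] ≡ n[ q , suc i ]
n-suc q i = begin
  q ^ (2 ^ i) ℕ.* q ^ (2 ^ i ∸ 1)    ≡⟨ ℕ.^-distribˡ-+-* q (2 ^ i) (2 ^ i ∸ 1) ⟨
  q ^ (2 ^ i ℕ.+ (2 ^ i ∸ 1))        ≡⟨ cong (q ^_) (ℕ.+-∸-assoc (2 ^ i) (ℕ.m^n>0 2 i)) ⟨
  -- `2 ^ suc i` computes to `2 ^ i + (2 ^ i + 0)`.
  q ^ (2 ^ i ℕ.+ 2 ^ i ∸ 1)          ≡⟨ cong (λ k → q ^ (2 ^ i ℕ.+ k ∸ 1)) (ℕ.+-identityʳ (2 ^ i)) ⟨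
  n[ q , suc i ]                     ∎
  where open ≡-Reasoning

-- Affine lines form a uniform linear hypergraph.

module AffineProperties (F : FiniteField q) (m : ℕ) where
  open FiniteField F
  open IsCommutativeRing isCommutativeRing
    using (+-assoc; +-comm; -‿inverse; +-identityˡ; +-identityʳ;
           distribʳ; *-assoc; *-comm; *-identityˡ; zeroˡ; zeroʳ)
  open Affine F m
  open Inverse finite using () renaming (from to decode)
  open ≡-Reasoning

  decode-injective : Injective _≡_ _≡_ decode
  decode-injective = Injection.injective (↔⇒↣ (↔-sym finite))

  x+[y-x]≡y : ∀ x y → x + (y + (- x)) ≡ y
  x+[y-x]≡y x y = begin
    x + (y + (- x))  ≡⟨ cong (x +_) (+-comm y (- x)) ⟩
    x + ((- x) + y)  ≡⟨ +-assoc x (- x) y ⟨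
    (x + (- x)) + y  ≡⟨ cong (_+ y) (proj₂ -‿inverse x) ⟩
    0# + y           ≡⟨ +-identityˡ y ⟩
    y                ∎

  +ᵥ-cancelˡ : ∀ x {v w} → x +ᵥ v ≡ x +ᵥ w → v ≡ w
  +ᵥ-cancelˡ x {v} {w} eq = trans (sym (cancel v)) (trans (cong (map -_ x +ᵥ_) eq) (cancel w))
    where
    cancel : ∀ v → map -_ x +ᵥ (x +ᵥ v) ≡ v
    cancel v = begin
      map -_ x +ᵥ (x +ᵥ v)  ≡⟨ zipWith-assoc +-assoc (map -_ x) x v ⟨
      map -_ x +ᵥ x +ᵥ v    ≡⟨ cong (_+ᵥ v) (zipWith-inverseˡ (proj₁ -‿inverse) x) ⟩
      0ᵥ +ᵥ v               ≡⟨ zipWith-identityˡ +-identityˡ v ⟩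
      v                     ∎

  -- Stated for vectors of every length, as induction on the vector requires, whereas `_*ᵥ_` is
  -- fixed to length `m`.
  *ᵥ-distribʳ : ∀ {k} (v : Vec Carrier k) s t →
                map ((s + t) *_) v ≡ zipWith _+_ (map (s *_) v) (map (t *_) v)
  *ᵥ-distribʳ []      s t = refl
  *ᵥ-distribʳ (x ∷ v) s t = cong₂ _∷_ (distribʳ x s t) (*ᵥ-distribʳ v s t)

  *ᵥ-assoc : ∀ s t v → (s * t) *ᵥ v ≡ s *ᵥ t *ᵥ v
  *ᵥ-assoc s t v = trans (map-cong (*-assoc s t) v) (map-∘ (s *_) (t *_) v)

  *ᵥ-identity : ∀ v → 1# *ᵥ v ≡ v
  *ᵥ-identity v = trans (map-cong *-identityˡ v) (map-id v)

  *ᵥ-zeroˡ : ∀ v → 0# *ᵥ v ≡ 0ᵥ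
  *ᵥ-zeroˡ v = trans (map-cong zeroˡ v) (map-const v 0#)

  *ᵥ-shift : ∀ b d s t → b +ᵥ (s + t) *ᵥ d ≡ b +ᵥ s *ᵥ d +ᵥ t *ᵥ d
  *ᵥ-shift b d s t =
    trans (cong (b +ᵥ_) (*ᵥ-distribʳ d s t)) (sym (zipWith-assoc +-assoc b (s *ᵥ d) (t *ᵥ d)))

  +ᵥ-zero : ∀ x d → x +ᵥ 0# *ᵥ d ≡ x
  +ᵥ-zero x d = trans (cong (x +ᵥ_) (*ᵥ-zeroˡ d)) (zipWith-identityʳ +-identityʳ x)

  divide : ∀ {u w v v′} → u ≢ 0# → u *ᵥ v ≡ w *ᵥ v′ → ∃ λ c → v ≡ (c * w) *ᵥ v′
  divide {u} {w} {v} {v′} u≢0 eq with c , uc≡1 ← inverse u u≢0 = c , (begin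
    v               ≡⟨ *ᵥ-identity v ⟨
    1# *ᵥ v         ≡⟨ cong (_*ᵥ v) (trans (*-comm c u) uc≡1) ⟨
    (c * u) *ᵥ v    ≡⟨ *ᵥ-assoc c u v ⟩
    c *ᵥ u *ᵥ v     ≡⟨ cong (c *ᵥ_) eq ⟩
    c *ᵥ w *ᵥ v′    ≡⟨ *ᵥ-assoc c w v′ ⟨
    (c * w) *ᵥ v′   ∎)

  point : Line → Carrier → Point
  point ℓ s = base ℓ +ᵥ s *ᵥ direction ℓ

  -- Moves the base of the parametrisation to the point with parameter `s`, so that two lines can be
  -- compared at a common point.
  point-shift : ∀ ℓ s s′ → point ℓ s′ ≡ point ℓ s +ᵥ (s′ + (- s)) *ᵥ direction ℓ
  point-shift ℓ s s′ =
    trans (cong (point ℓ) (sym (x+[y-x]≡y s s′))) (*ᵥ-shift (base ℓ) (direction ℓ) s (s′ + (- s)))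

  point-injective : ∀ ℓ → Injective _≡_ _≡_ (point ℓ)
  point-injective ℓ {s} {s′} eq with inj⇒≟ (↔⇒↣ finite) (s′ + (- s)) 0#
  ... | yes s′-s≡0 = trans (sym (+-identityʳ s)) (trans (cong (s +_) (sym s′-s≡0)) (x+[y-x]≡y s s′))
  ... | no  s′-s≢0 = contradiction direction≡0 (direction≢0 ℓ)
    where
    d = direction ℓ

    direction≡0 : d ≡ 0ᵥ
    -- With `w = 0#`, `divide` says that a vector with a vanishing nonzero multiple is itself zero.
    direction≡0 with c , d≡ ← divide {w = 0#} {v′ = d} s′-s≢0 (+ᵥ-cancelˡ (point ℓ s) (begin
        point ℓ s +ᵥ (s′ + (- s)) *ᵥ d  ≡⟨ point-shift ℓ s s′ ⟨
        point ℓ s′                      ≡⟨ eq ⟨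
        point ℓ s                       ≡⟨ +ᵥ-zero (point ℓ s) d ⟨
        point ℓ s +ᵥ 0# *ᵥ d            ∎))
      = trans d≡ (trans (cong (_*ᵥ d) (zeroʳ c)) (*ᵥ-zeroˡ d))

  points-listing : ∀ ℓ → Listing q (points ℓ)
  points-listing ℓ = record
    { elem      = point ℓ ∘ decode
    ; injective = decode-injective ∘ point-injective ℓ
    ; image     = λ x → mk⇔
        (λ (s , x≡) → Inverse.to finite s
                    , trans (cong (point ℓ) (Inverse.strictlyInverseʳ finite s)) (sym x≡))
        (λ (a , eq) → decode a , sym eq)
    }

  -- With both lines based at `x`, the displacement to `y` is a multiple of either direction. It is
  -- nonzero because `x ≢ y`, so the direction of `ℓ` is a multiple of that of `ℓ′`.
  points-⊆ : ∀ ℓ ℓ′ {x y} → x ≢ y → x ∈ points ℓ → y ∈ points ℓ →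
             x ∈ points ℓ′ → y ∈ points ℓ′ → points ℓ ⊆ points ℓ′
  points-⊆ ℓ ℓ′ {x} {y} x≢y (s , x≡) (s′ , y≡) (t , x≡′) (t′ , y≡′) {z} (r , z≡) =
    -- `t` is the parameter of `x` on `ℓ′`, `k` the displacement from `x` to `z` along `ℓ`, and `e`
    -- the factor between the two directions.
    t + (k * e) , (begin
      z                                ≡⟨ from-x ℓ x≡ z≡ ⟩
      x +ᵥ k *ᵥ d                      ≡⟨ cong (λ v → x +ᵥ k *ᵥ v) d≡ ⟩
      x +ᵥ k *ᵥ e *ᵥ d′                ≡⟨ cong₂ _+ᵥ_ x≡′ (sym (*ᵥ-assoc k e d′)) ⟩
      point ℓ′ t +ᵥ (k * e) *ᵥ d′      ≡⟨ *ᵥ-shift (base ℓ′) d′ t (k * e) ⟨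
      point ℓ′ (t + (k * e))             ∎)
    where
    d  = direction ℓ
    d′ = direction ℓ′
    k  = r + (- s)

    from-x : ∀ ℓ {x y s s′} → x ≡ point ℓ s → y ≡ point ℓ s′ →
             y ≡ x +ᵥ (s′ + (- s)) *ᵥ direction ℓ
    from-x ℓ refl refl = point-shift ℓ _ _

    s′-s≢0 : s′ + (- s) ≢ 0#
    s′-s≢0 eq = x≢y (sym (trans (from-x ℓ x≡ y≡) (trans (cong (λ c → x +ᵥ c *ᵥ d) eq) (+ᵥ-zero x d))))

    proportional : ∃ λ c → d ≡ (c * (t′ + (- t))) *ᵥ d′
    proportional = divide s′-s≢0 (+ᵥ-cancelˡ x (trans (sym (from-x ℓ x≡ y≡)) (from-x ℓ′ x≡′ y≡′)))

    e  = proj₁ proportional * (t′ + (- t))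
    d≡ = proj₂ proportional

  lines-uniform : (C : ParallelClasses n) → Uniform q (linesOf C)
  lines-uniform C (ℓ , _) = points-listing ℓ

  lines-linear : (C : ParallelClasses n) → Linear (linesOf C)
  lines-linear C (ℓ , _) (ℓ′ , _) x≢y x∈ℓ y∈ℓ x∈ℓ′ y∈ℓ′ =
    points-⊆ ℓ ℓ′ x≢y x∈ℓ y∈ℓ x∈ℓ′ y∈ℓ′ , points-⊆ ℓ′ ℓ x≢y x∈ℓ′ y∈ℓ′ x∈ℓ y∈ℓ

-- Induction along the recursion.

A-order : (F : FiniteField q) → IsA F t G → HasOrder G n[ q , t ]
-- `n[ q , 1 ]` computes to `q * 1`.
A-order {q} F A-one = subst (λ k → Fin q ↔ Fin k) (sym (ℕ.*-identityʳ q)) ↔-refl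
A-order {q} F (A-suc {i} {G} _ _ copy enum) =
  subst (HasOrder (Γ G _ copy enum)) (n-suc q i)
    (↔-trans (Vec↔Fin (FiniteField.finite F) (2 ^ i) ×-↔ ↔-refl) (↔-sym *↔×))

A-constantLink : (F : FiniteField (suc r)) → IsA F t G → ConstantLink G (t · K r)
A-constantLink F A-one = K-constantLink
A-constantLink F (A-suc {i} A C copy enum) =
  Γ-constantLink copy enum (lines-uniform C) (A-constantLink F A)
  where open AffineProperties F (2 ^ i)

A-C₄-free : q ≤ 3 → (F : FiniteField q) → IsA F t G → C[ 4 ]-free G
A-C₄-free q≤3 F A-one = K-cycle-free q≤3
A-C₄-free q≤3 F (A-suc {i} {G} A C copy enum) =
  ΓProperties.C₄-free G _ copy enum (lines-uniform C) (lines-linear C) q≤3 (A-C₄-free q≤3 F A)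
  where open AffineProperties F (2 ^ i)

A-C₅-free : q ≤ 4 → (F : FiniteField q) → IsA F t G → C[ 5 ]-free G
A-C₅-free q≤4 F A-one = K-cycle-free q≤4
A-C₅-free q≤4 F (A-suc {i} {G} A C copy enum) =
  ΓProperties.C₅-free G _ copy enum (lines-uniform C) (lines-linear C) q≤4 (A-C₅-free q≤4 F A)
  where open AffineProperties F (2 ^ i)

theorem17 : (∀ (q : ℕ) → PrimePower q → (F : FiniteField q) →
    ∀ (t : ℕ) → t ≥ 1 → (A : Graph) → IsA F t A →
    HasOrder A n[ q , t ] × ConstantLink A (t · K (q ∸ 1)))
    × (∀ (F : FiniteField 3) (t : ℕ) → t ≥ 1 → (A : Graph) → IsA F t A →
    C[ 4 ]-free A × C[ 5 ]-free A)
    × (∀ (F : FiniteField 4) (t : ℕ) → t ≥ 1 → (A : Graph) → IsA F t A →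
    C[ 5 ]-free A)
theorem17 =
    (λ where
      -- The element `0#` rules out a field of order zero; for `suc r` the link size `q ∸ 1`
      -- computes to `r`.
      zero    _ F → contradiction (Inverse.to (FiniteField.finite F) (FiniteField.0# F)) λ ()
      (suc r) _ F t _ A isA → A-order F isA , A-constantLink F isA)
  , (λ F t _ A isA → A-C₄-free ℕ.≤-refl F isA , A-C₅-free (ℕ.n≤1+n 3) F isA)
  , (λ F t _ A isA → A-C₅-free ℕ.≤-refl F isA)
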